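{- Let $G=(V,E)$ be a finite simple connected graph with an edge $e=uv$. Then $\beth^{1}(G/e)\le \beth^{1}(G)$.
   Context: All graphs are finite and simple. For an edge $e=uv$, $G/e$ is the simple graph obtained by contracting $e$: the vertices $u,v$ are replaced by a single vertex $v_e$ adjacent to exactly those other vertices that are adjacent to $u$ or $v$ in $G$ (no loops or multiple edges are created). The first graph characteristic is $\beth^{1}(G)=|E(G)|-|V(G)|$. -}

module Defs where

open import Data.Integer.Base using (ℤ; +_; _-_)
open import Data.List.Base using (List; []; _∷_; _++_; length; map; filter)
open import Data.List.Membership.Propositional using (_∈_)
open import Data.List.Membership.Propositional.Properties using (∈-map⁺; ∈-filter⁺)
import Data.List.Relation.Unary.All as All
import Data.List.Relation.Unary.All.Properties as All
open import Data.List.Relation.Unary.AllPairs using (_∷_)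
open import Data.List.Relation.Unary.Any using (here; there)
open import Data.List.Relation.Unary.Unique.Propositional using (Unique)
import Data.List.Relation.Unary.Unique.Propositional.Properties as Unique
open import Data.Maybe.Base using (Maybe; just; nothing)
import Data.Maybe.Properties as Maybe
open import Data.Product.Base using (_×_; _,_)
open import Data.Sum.Base using (_⊎_; inj₁; inj₂)
open import Level using (suc)
open import Relation.Binary.Construct.Closure.ReflexiveTransitive using (Star)
open import Relation.Binary.Core using (Rel)
open import Relation.Binary.Definitions
  using (DecidableEquality; Decidable; Symmetric; Irreflexive)
open import Relation.Binary.PropositionalEquality using (_≡_; _≢_; refl)
open import Relation.Nullary.Decidable using (no; ¬?; _×-dec_; _⊎-dec_; map′)
import Relation.Unary as U

-- Each two-element sublist once; for a duplicate-free list these are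
-- exactly the unordered pairs of distinct members.
pairs : ∀ {a} {A : Set a} → List A → List (A × A)
pairs []       = []
pairs (x ∷ xs) = map (x ,_) xs ++ pairs xs

-- The vertex set is a finite subset of an ambient type, given by a
-- duplicate-free list; elements of the type outside the list are not vertices
-- and, by adj⇒∈ and symmetry, are adjacent to nothing.
record Graph ℓ : Set (suc ℓ) where
  infix 4 _≟_ _~_ _~?_
  field
    Label  : Set ℓ
    _≟_    : DecidableEquality Label
    V      : List Label
    unique : Unique V
    _~_    : Rel Label ℓ
    _~?_   : Decidable _~_
    sym    : Symmetric _~_
    irrefl : Irreflexive _≡_ _~_
    adj⇒∈  : ∀ {x y} → x ~ y → x ∈ V

  E : List (Label × Label)
  E = filter (λ (x , y) → x ~? y) (pairs V)

Connected : ∀ {ℓ} → Graph ℓ → Set ℓ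
Connected G = ∀ {x y} → x ∈ V → y ∈ V → Star _~_ x y
  where open Graph G

ℶ¹ : ∀ {ℓ} → Graph ℓ → ℤ
ℶ¹ G = + length E - + length V
  where open Graph G

pattern vₑ = nothing

module Contraction {ℓ} (G : Graph ℓ) (u v : Graph.Label G) where
  open Graph G

  Kept : U.Pred Label ℓ
  Kept x = x ≢ u × x ≢ v

  kept? : U.Decidable Kept
  kept? x = ¬? (x ≟ u) ×-dec ¬? (x ≟ v)

  data Adj : Rel (Maybe Label) ℓ where
    old  : ∀ {x y} → Kept x → Kept y → x ~ y → Adj (just x) (just y)
    to   : ∀ {x} → Kept x → x ~ u ⊎ x ~ v → Adj (just x) vₑ
    from : ∀ {x} → Kept x → x ~ u ⊎ x ~ v → Adj vₑ (just x)

  adj? : Decidable Adj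
  adj? (just x) (just y) =
    map′ (λ (p , q , r) → old p q r) (λ { (old p q r) → p , q , r })
         (kept? x ×-dec kept? y ×-dec (x ~? y))
  adj? (just x) vₑ =
    map′ (λ (p , q) → to p q) (λ { (to p q) → p , q })
         (kept? x ×-dec ((x ~? u) ⊎-dec (x ~? v)))
  adj? vₑ (just x) =
    map′ (λ (p , q) → from p q) (λ { (from p q) → p , q })
         (kept? x ×-dec ((x ~? u) ⊎-dec (x ~? v)))
  adj? vₑ vₑ = no λ ()

  adj-sym : Symmetric Adj
  adj-sym (old p q r) = old q p (sym r)
  adj-sym (to p q)    = from p q
  adj-sym (from p q)  = to p q

  adj-irrefl : Irreflexive _≡_ Adj
  adj-irrefl refl (old _ _ r) = irrefl refl r

  vertices : List (Maybe Label)
  vertices = vₑ ∷ map just (filter kept? V)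

  vertices-unique : Unique vertices
  vertices-unique =
    All.map⁺ (All.universal (λ _ ()) _) ∷
    Unique.map⁺ Maybe.just-injective (Unique.filter⁺ kept? unique)

  kept∈ : ∀ {x} → Kept x → x ∈ V → just x ∈ vertices
  kept∈ p x∈V = there (∈-map⁺ just (∈-filter⁺ kept? x∈V p))

  adj⇒∈vertices : ∀ {x y} → Adj x y → x ∈ vertices
  adj⇒∈vertices (old p _ r)     = kept∈ p (adj⇒∈ r)
  adj⇒∈vertices (to p (inj₁ r)) = kept∈ p (adj⇒∈ r)
  adj⇒∈vertices (to p (inj₂ r)) = kept∈ p (adj⇒∈ r)
  adj⇒∈vertices (from _ _)      = here refl

  contract : Graph ℓ
  contract = record
    { Label  = Maybe Label
    ; _≟_    = Maybe.≡-dec _≟_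
    ; V      = vertices
    ; unique = vertices-unique
    ; _~_    = Adj
    ; _~?_   = adj?
    ; sym    = adj-sym
    ; irrefl = adj-irrefl
    ; adj⇒∈  = adj⇒∈vertices
    }

infixl 7 _/_

_/_ : ∀ {ℓ} (G : Graph ℓ) {u v : Graph.Label G} → Graph._~_ G u v → Graph ℓ
_/_ G {u} {v} _ = Contraction.contract G u v

{-# OPTIONS --safe #-}

-- Contracting uv removes exactly one vertex and at least one edge. To compare
-- the two edge counts, list the vertices of G as u, v, W: the edges of G are uv,
-- those from u to W, those from v to W and those within W, whereas G / uv has the
-- edges within W and at most one edge from vₑ for each edge from u or v to W.
-- This uses that the edge count does not depend on the order of the vertex list.

module Submission where

open import Defs
open import Data.Integer.Base using (_≤_; _⊖_)
import Data.Integer.Properties as ℤ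
open import Data.List.Base using (List; []; _∷_; _++_; length; map; filter)
open import Data.List.Membership.Propositional using (_∈_)
open import Data.List.Membership.Propositional.Properties using (∈-∃++)
open import Data.List.Properties
  using (filter-++; filter-accept; filter-all; filter-reject; length-++; length-map)
open import Data.List.Relation.Binary.Permutation.Propositional
  using (_↭_; refl; prep; swap; trans; ↭-reflexive; ↭⇒↭ₛ)
open import Data.List.Relation.Binary.Permutation.Propositional.Properties
  using (↭-length; filter-↭; ∈-resp-↭; shift; map⁺)
import Data.List.Relation.Binary.Permutation.Setoid.Properties as Permutation
open import Data.List.Relation.Binary.Sublist.Propositional using (⊆-refl)
import Data.List.Relation.Binary.Sublist.Propositional.Properties as Sublist
open import Data.List.Relation.Unary.All as All using (_∷_)
open import Data.List.Relation.Unary.AllPairs using (_∷_)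
open import Data.List.Relation.Unary.Any using (here; there)
open import Data.List.Relation.Unary.Unique.Propositional using (Unique)
open import Data.Maybe.Base using (just)
open import Data.Nat.Base as ℕ using (ℕ; suc; _+_; z≤n; s≤s)
import Data.Nat.Properties as ℕ
open import Algebra.Properties.CommutativeSemigroup ℕ.+-commutativeSemigroup
  using (x∙yz≈y∙xz)
open import Data.Product.Base using (∃-syntax; _,_)
open import Data.Sum.Base as Sum using (_⊎_)
open import Function.Base using (_∘_)
open import Relation.Binary.Core using (Rel)
open import Relation.Binary.Definitions using (Decidable; Symmetric)
open import Relation.Binary.PropositionalEquality
  using (_≡_; _≢_; refl; sym; cong; cong₂; setoid; module ≡-Reasoning)
  renaming (trans to ≡-trans)
open import Relation.Nullary.Decidable using (yes; no; _⊎-dec_)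
open import Relation.Nullary.Negation using (contradiction)
import Relation.Unary as U

module _ {a p} {A : Set a} {P : U.Pred A p} (P? : U.Decidable P) where

  count : List A → ℕ
  count xs = length (filter P? xs)

module _ {a b p} {A : Set a} {B : Set b} {P : U.Pred B p} (P? : U.Decidable P) where

  count-map : ∀ (f : A → B) xs → count P? (map f xs) ≡ count (P? ∘ f) xs
  count-map f []       = refl
  count-map f (x ∷ xs) with P? (f x)
  ... | yes _ = cong suc (count-map f xs)
  ... | no  _ = count-map f xs

module _ {a p q} {A : Set a} {P : U.Pred A p} {Q : U.Pred A q}
         (P? : U.Decidable P) (Q? : U.Decidable Q) where

  count-mono : (∀ {x} → P x → Q x) → ∀ xs → count P? xs ℕ.≤ count Q? xs
  count-mono P⇒Q xs =
    Sublist.length-mono-≤ (Sublist.filter⁺ P? Q? (λ { refl → P⇒Q }) (⊆-refl {x = xs}))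

  -- An entry satisfying both predicates is counted once on the left and twice on the right, so
  -- equality fails in general. Applied to adjacency to `u` and to `v`, such entries are the common
  -- neighbours.
  count-∪ : ∀ xs → count (λ x → P? x ⊎-dec Q? x) xs ℕ.≤ count P? xs + count Q? xs
  count-∪ []       = z≤n
  count-∪ (x ∷ xs) with ih ← count-∪ xs | P? x | Q? x
  ... | yes _ | yes _ = s≤s (ℕ.≤-trans ih (ℕ.+-monoʳ-≤ (count P? xs) (ℕ.n≤1+n _)))
  ... | yes _ | no  _ = s≤s ih
  ... | no  _ | yes _ = ℕ.≤-trans (s≤s ih) (ℕ.≤-reflexive (sym (ℕ.+-suc _ _)))
  ... | no  _ | no  _ = ih

module _ {a r} {A : Set a} {R : Rel A r} (R? : Decidable R) where

  -- With the adjacency test and vertex list of a graph this unfolds to `length E`. The list is a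
  -- free argument so that edges can also be counted along a reordered vertex list or within a part
  -- of it.
  countPairs : List A → ℕ
  countPairs xs = count (λ (x , y) → R? x y) (pairs xs)

  countPairs-∷ : ∀ x xs → countPairs (x ∷ xs) ≡ count (R? x) xs + countPairs xs
  countPairs-∷ x xs = begin
    length (filter R?′ (map (x ,_) xs ++ pairs xs))
      ≡⟨ cong length (filter-++ R?′ (map (x ,_) xs) (pairs xs)) ⟩
    length (filter R?′ (map (x ,_) xs) ++ filter R?′ (pairs xs))
      ≡⟨ length-++ (filter R?′ (map (x ,_) xs)) ⟩
    count R?′ (map (x ,_) xs) + countPairs xs
      ≡⟨ cong (_+ countPairs xs) (count-map R?′ (x ,_) xs) ⟩
    count (R? x) xs + countPairs xs ∎
    where
    open ≡-Reasoning
    R?′ : U.Decidable (λ (x , y) → R x y)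
    R?′ (x , y) = R? x y

  countPairs-∷∷ : ∀ x y xs → countPairs (x ∷ y ∷ xs) ≡
                  count (R? x) (y ∷ xs) + (count (R? y) xs + countPairs xs)
  countPairs-∷∷ x y xs = ≡-trans (countPairs-∷ x (y ∷ xs))
    (cong (count (R? x) (y ∷ xs) +_) (countPairs-∷ y xs))

  -- The exchange affects only the pair formed by the two heads, which turns from `(x , y)` into
  -- `(y , x)`.
  countPairs-swap : Symmetric R → ∀ x y xs →
                    countPairs (x ∷ y ∷ xs) ≡ countPairs (y ∷ x ∷ xs)
  countPairs-swap R-sym x y xs = begin
    countPairs (x ∷ y ∷ xs)
      ≡⟨ countPairs-∷∷ x y xs ⟩
    count (R? x) (y ∷ xs) + (count (R? y) xs + countPairs xs)
      ≡⟨ exchange ⟩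
    count (R? y) (x ∷ xs) + (count (R? x) xs + countPairs xs)
      ≡⟨ countPairs-∷∷ y x xs ⟨
    countPairs (y ∷ x ∷ xs) ∎
    where
    open ≡-Reasoning
    exchange : count (R? x) (y ∷ xs) + (count (R? y) xs + countPairs xs) ≡
               count (R? y) (x ∷ xs) + (count (R? x) xs + countPairs xs)
    -- Deciding both tests lets the filters reduce at their heads. Symmetry excludes the mixed
    -- cases, and otherwise the two sides differ by the order of two summands.
    exchange with R? x y | R? y x
    ... | yes _   | yes _   = cong suc (x∙yz≈y∙xz (count (R? x) xs) (count (R? y) xs) (countPairs xs))
    ... | yes xRy | no ¬yRx = contradiction (R-sym xRy) ¬yRx
    ... | no ¬xRy | yes yRx = contradiction (R-sym yRx) ¬xRy
    ... | no _    | no _    = x∙yz≈y∙xz (count (R? x) xs) (count (R? y) xs) (countPairs xs)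

  -- `pairs` lists each pair in one orientation only, dictated by the list order; symmetry makes
  -- that choice irrelevant. Induction on the derivation of the permutation.
  countPairs-↭ : Symmetric R → ∀ {xs ys} → xs ↭ ys → countPairs xs ≡ countPairs ys
  countPairs-↭ R-sym refl = refl
  countPairs-↭ R-sym {_ ∷ xs} {_ ∷ ys} (prep x p) = begin
    countPairs (x ∷ xs)             ≡⟨ countPairs-∷ x xs ⟩
    count (R? x) xs + countPairs xs ≡⟨ cong₂ _+_ (↭-length (filter-↭ (R? x) p))
                                                 (countPairs-↭ R-sym p) ⟩
    count (R? x) ys + countPairs ys ≡⟨ countPairs-∷ x ys ⟨
    countPairs (x ∷ ys)             ∎
    where open ≡-Reasoning
  countPairs-↭ R-sym {_ ∷ _ ∷ xs} {_ ∷ _ ∷ ys} (swap x y p) = begin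
    countPairs (x ∷ y ∷ xs)
      ≡⟨ countPairs-swap R-sym x y xs ⟩
    countPairs (y ∷ x ∷ xs)
      ≡⟨ countPairs-∷∷ y x xs ⟩
    count (R? y) (x ∷ xs) + (count (R? x) xs + countPairs xs)
      ≡⟨ cong₂ _+_ (↭-length (filter-↭ (R? y) (prep x p)))
           (cong₂ _+_ (↭-length (filter-↭ (R? x) p)) (countPairs-↭ R-sym p)) ⟩
    count (R? y) (x ∷ ys) + (count (R? x) ys + countPairs ys)
      ≡⟨ countPairs-∷∷ y x ys ⟨
    countPairs (y ∷ x ∷ ys) ∎
    where open ≡-Reasoning
  countPairs-↭ R-sym (trans p q) = ≡-trans (countPairs-↭ R-sym p) (countPairs-↭ R-sym q)

module _ {a b r s} {A : Set a} {B : Set b} {R : Rel B r} {S : Rel A s}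
         (R? : Decidable R) (S? : Decidable S) where

  -- Pairs are formed by position, so `f` acts on them one by one and need not be injective. With
  -- `f = just` it bounds the edges of the contraction that avoid `vₑ`.
  countPairs-map-mono : (f : A → B) → (∀ {x y} → R (f x) (f y) → S x y) →
                        ∀ xs → countPairs R? (map f xs) ℕ.≤ countPairs S? xs
  countPairs-map-mono f R⇒S []       = z≤n
  countPairs-map-mono f R⇒S (x ∷ xs) = begin
    countPairs R? (map f (x ∷ xs))
      ≡⟨ countPairs-∷ R? (f x) (map f xs) ⟩
    count (R? (f x)) (map f xs) + countPairs R? (map f xs)
      ≡⟨ cong (_+ countPairs R? (map f xs)) (count-map (R? (f x)) f xs) ⟩
    count (R? (f x) ∘ f) xs + countPairs R? (map f xs)
      ≤⟨ ℕ.+-mono-≤ (count-mono (R? (f x) ∘ f) (S? x) R⇒S xs)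
                    (countPairs-map-mono f R⇒S xs) ⟩
    count (S? x) xs + countPairs S? xs
      ≡⟨ countPairs-∷ S? x xs ⟨
    countPairs S? (x ∷ xs) ∎
    where open ℕ.≤-Reasoning

module _ {a} {A : Set a} where

  ∈⇒↭∷ : ∀ {x : A} {xs} → x ∈ xs → ∃[ ys ] xs ↭ x ∷ ys
  ∈⇒↭∷ x∈xs with ys , zs , eq ← ∈-∃++ x∈xs =
    ys ++ zs , trans (↭-reflexive eq) (shift _ ys zs)

  ∈∈⇒↭∷∷ : ∀ {x y : A} {xs} → x ≢ y → x ∈ xs → y ∈ xs → ∃[ zs ] xs ↭ x ∷ y ∷ zs
  ∈∈⇒↭∷∷ x≢y x∈xs y∈xs with ys , p ← ∈⇒↭∷ x∈xs | ∈-resp-↭ p y∈xs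
  ... | here y≡x    = contradiction (sym y≡x) x≢y
  ... | there y∈ys with zs , q ← ∈⇒↭∷ y∈ys = zs , trans p (prep _ q)

module _ {ℓ} (G : Graph ℓ) {u v : Graph.Label G} (e : Graph._~_ G u v) where
  open Graph G renaming (sym to ~-sym)
  open Contraction G u v

  V↭uvW : ∃[ W ] V ↭ u ∷ v ∷ W
  V↭uvW = ∈∈⇒↭∷∷ (λ u≡v → irrefl u≡v e) (adj⇒∈ e) (adj⇒∈ (~-sym e))

  -- `u` and `v` are rejected at the head, and uniqueness separates every member of `W` from both.
  filter-kept : ∀ {W} → Unique (u ∷ v ∷ W) → filter kept? (u ∷ v ∷ W) ≡ W
  filter-kept {W} ((_ ∷ u∉W) ∷ v∉W ∷ _) = begin
    filter kept? (u ∷ v ∷ W) ≡⟨ filter-reject kept? (λ (u≢u , _) → u≢u refl) ⟩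
    filter kept? (v ∷ W)     ≡⟨ filter-reject kept? (λ (_ , v≢v) → v≢v refl) ⟩
    filter kept? W           ≡⟨ filter-all kept? (All.zipWith
                                  (λ (u≢x , v≢x) → u≢x ∘ sym , v≢x ∘ sym) (u∉W , v∉W)) ⟩
    W                        ∎
    where open ≡-Reasoning

  vertices↭ : ∀ {W} → V ↭ u ∷ v ∷ W → vertices ↭ vₑ ∷ map just W
  vertices↭ p = prep vₑ (map⁺ just (trans (filter-↭ kept? p)
    -- Uniqueness of `V` is carried along the permutation to `u ∷ v ∷ W`.
    (↭-reflexive (filter-kept (Permutation.Unique-resp-↭ (setoid Label) (↭⇒↭ₛ p) unique)))))

  length-vertices : suc (length vertices) ≡ length V
  length-vertices with W , p ← V↭uvW = begin
    suc (length vertices)              ≡⟨ cong suc (↭-length (vertices↭ p)) ⟩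
    suc (length (vₑ ∷ map just W))     ≡⟨ cong (suc ∘ suc) (length-map just W) ⟩
    length (u ∷ v ∷ W)                 ≡⟨ ↭-length p ⟨
    length V                           ∎
    where open ≡-Reasoning

  -- Every edge at `vₑ` comes from an edge at `u` or at `v`. The bound is strict exactly when `u`
  -- and `v` have a common neighbour in `W`, provided that all of `W` is kept.
  degree-vₑ : ∀ W → count (adj? vₑ) (map just W) ℕ.≤ count (u ~?_) W + count (v ~?_) W
  degree-vₑ W = begin
    count (adj? vₑ) (map just W)              ≡⟨ count-map (adj? vₑ) just W ⟩
    count (adj? vₑ ∘ just) W                  ≤⟨ count-mono _ _ neighbour W ⟩
    count (λ x → (u ~? x) ⊎-dec (v ~? x)) W   ≤⟨ count-∪ (u ~?_) (v ~?_) W ⟩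
    count (u ~?_) W + count (v ~?_) W         ∎
    where
    open ℕ.≤-Reasoning
    neighbour : ∀ {x} → Adj vₑ (just x) → u ~ x ⊎ v ~ x
    neighbour (from _ x~u⊎x~v) = Sum.map ~-sym ~-sym x~u⊎x~v

  length-E-contract : length (Graph.E contract) ℕ.< length E
  length-E-contract with W , p ← V↭uvW = begin
    suc (countPairs adj? vertices)
      ≡⟨ cong suc (countPairs-↭ adj? adj-sym (vertices↭ p)) ⟩
    suc (countPairs adj? (vₑ ∷ map just W))
      ≡⟨ cong suc (countPairs-∷ adj? vₑ (map just W)) ⟩
    suc (count (adj? vₑ) (map just W) + countPairs adj? (map just W))
      ≤⟨ s≤s (ℕ.+-mono-≤ (degree-vₑ W)
           (countPairs-map-mono adj? _~?_ just (λ { (old _ _ x~y) → x~y }) W)) ⟩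
    suc (count (u ~?_) W + count (v ~?_) W + countPairs _~?_ W)
      ≡⟨ cong suc (ℕ.+-assoc (count (u ~?_) W) _ _) ⟩
    suc (count (u ~?_) W) + (count (v ~?_) W + countPairs _~?_ W)
      -- The spare `suc` is the contracted edge itself: `v` passes the test of adjacency to `u` at
      -- the head of `v ∷ W`. This is what makes the inequality strict.
      ≡⟨ cong (λ es → length es + _) (filter-accept (u ~?_) e) ⟨
    count (u ~?_) (v ∷ W) + (count (v ~?_) W + countPairs _~?_ W)
      ≡⟨ countPairs-∷∷ _~?_ u v W ⟨
    countPairs _~?_ (u ∷ v ∷ W)
      ≡⟨ countPairs-↭ _~?_ ~-sym p ⟨
    countPairs _~?_ V ∎
    where open ℕ.≤-Reasoning

theorem2p1p1 : ∀ {ℓ} (G : Graph ℓ) → Connected G →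
    ∀ {u v} (e : Graph._~_ G u v) → ℶ¹ (G / e) ≤ ℶ¹ G
theorem2p1p1 G _ e = begin
  ℶ¹ (G / e)                  ≡⟨ ℤ.m-n≡m⊖n (length E′) (length V′) ⟩
  -- Raising both counts by one keeps the difference; the vertex counts then agree, and the strict
  -- edge inequality is exactly the bound on `suc (length E′)`.
  length E′ ⊖ length V′       ≡⟨ ℤ.[1+m]⊖[1+n]≡m⊖n (length E′) (length V′) ⟨
  suc (length E′) ⊖ suc (length V′)
                              ≡⟨ cong (suc (length E′) ⊖_) (length-vertices G e) ⟩
  suc (length E′) ⊖ length V  ≤⟨ ℤ.⊖-monoˡ-≤ (length V) (length-E-contract G e) ⟩
  length E ⊖ length V         ≡⟨ ℤ.m-n≡m⊖n (length E) (length V) ⟨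
  ℶ¹ G                        ∎
  where
  open ℤ.≤-Reasoning
  open Graph G using (E; V)
  open Graph (G / e) using () renaming (E to E′; V to V′)
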